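{- Let $n\ge1$ and let $\pi,\sigma\in\mathcal{S}_n$ be $1\text{ - }3\text{ - }2$-avoiding permutations. Then $\Lambda(\pi)\subset\Lambda(\sigma)$ (proper containment of Young diagrams) if and only if $\pi<\sigma$ in the (strong) Bruhat order on $\mathcal{S}_n$.
   Context: $\mathcal{S}_n$ is the set of permutations $\pi=\pi_1\cdots\pi_n$ of $[n]=\{1,\ldots,n\}$, written as words. A permutation $\pi$ avoids $1\text{ - }3\text{ - }2$ if there are no $i<j<k$ with $\pi_i<\pi_k<\pi_j$. The standardization $w^{\ast}$ of a word $w$ of $m$ distinct positive integers is the permutation in $\mathcal{S}_m$ obtained by replacing the $i$th smallest letter by $i$. The map $D$ from permutations in $\mathcal{S}_n$ to Dyck words of length $2n$ in the letters $\mathsf{u}$ (up step $(0,1)$) and $\mathsf{r}$ (right step $(1,0)$) is defined recursively by $D(\emptyset)=\emptyset$ and, for $\pi=\pi_L\,n\,\pi_R\in\mathcal{S}_n$ with $n\ge1$ ($\pi_L,\pi_R$ the possibly empty words to the left and right of the letter $n$), $D(\pi)=\mathsf{u}\,D(\pi_L^{\ast})\,\mathsf{r}\,D(\pi_R^{\ast})$. $\Lambda(\pi)$ is the partition with exactly $n-1$ parts (parts equal to $0$ allowed) whose Young diagram is the region above the path $D(\pi)$ drawn from $(0,0)$ to $(n,n)$. Equivalently, the parts of $\Lambda(\pi)$ are, in weakly decreasing order, the numbers of letters $\mathsf{r}$ preceding the 2nd, 3rd, ..., $n$th letter $\mathsf{u}$ in $D(\pi)$. Containment of partitions is containment of Young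 diagrams, i.e. partwise $\le$. The strong Bruhat order on $\mathcal{S}_n$ is the partial order whose covering relations are: $\pi$ is covered by $\sigma$ if $\sigma$ is obtained from $\pi$ by exchanging the entries in positions $i<j$ with $\pi_i<\pi_j$ and $\sigma$ has exactly one more inversion than $\pi$. -}

module Defs where

open import Data.Nat.Base using (ℕ; zero; suc; _+_; _≤_)
open import Data.Nat.Properties using (_≟_; _≤?_; _<?_)
open import Data.Fin.Base using (Fin; toℕ) renaming (_<_ to _<ᶠ_)
open import Data.Fin.Permutation
  using (Permutation′; _⟨$⟩ʳ_; _∘ₚ_; transpose; _≈_)
open import Data.List.Base
  using (List; []; _∷_; _++_; length; map; filter; drop; reverse; tabulate; takeWhile; dropWhile)
open import Data.List.Relation.Binary.Pointwise.Base using (Pointwise)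
open import Data.Product.Base using (_×_; ∃-syntax)
open import Relation.Binary.Construct.Closure.Transitive using (TransClosure)
open import Relation.Binary.PropositionalEquality.Core using (_≡_; _≢_)
open import Relation.Nullary using (¬_)
open import Relation.Nullary.Decidable using (¬?)

private
  variable
    n : ℕ

-- 𝒮ₙ is the library's Permutation′ n, acting on Fin n = {0,…,n-1}; letters are
-- shifted by one so that words use the alphabet {1,…,n}.
word : Permutation′ n → List ℕ
word π = tabulate (λ i → suc (toℕ (π ⟨$⟩ʳ i)))

Avoids132 : Permutation′ n → Set
Avoids132 {n} π = ∀ (i j k : Fin n) → i <ᶠ j → j <ᶠ k →
  ¬ ((π ⟨$⟩ʳ i) <ᶠ (π ⟨$⟩ʳ k) × (π ⟨$⟩ʳ k) <ᶠ (π ⟨$⟩ʳ j))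

-- In a word with distinct letters, the ith smallest letter x is the one
-- with exactly i letters ≤ x.
standardize : List ℕ → List ℕ
standardize w = map (λ x → length (filter (_≤? x) w)) w

data Step : Set where
  u r : Step

leftOf rightOf : ℕ → List ℕ → List ℕ
leftOf  m w = takeWhile (λ x → ¬? (x ≟ m)) w
rightOf m w = drop 1 (dropWhile (λ x → ¬? (x ≟ m)) w)

-- For w ∈ 𝒮ₘ the letter m is length w.  The first argument only makes the
-- recursion structural: both subwords omit the letter m, so they are shorter
-- than w, and any value ≥ length w gives the same result.
dyckWithin : ℕ → List ℕ → List Step
dyckWithin zero    w  = []
dyckWithin (suc b) [] = []
dyckWithin (suc b) w@(_ ∷ _) =
  u ∷ dyckWithin b (standardize (leftOf (length w) w))
  ++ r ∷ dyckWithin b (standardize (rightOf (length w) w))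

dyck : List ℕ → List Step
dyck w = dyckWithin (length w) w

D : Permutation′ n → List Step
D π = dyck (word π)

-- For every letter u, the number of letters r before it, where a of them have
-- already been read.
rsBeforeUs : ℕ → List Step → List ℕ
rsBeforeUs a []      = []
rsBeforeUs a (u ∷ s) = a ∷ rsBeforeUs a s
rsBeforeUs a (r ∷ s) = rsBeforeUs (suc a) s

-- The counts increase weakly along the path, so reversing lists the parts in
-- weakly decreasing order; drop 1 discards the first letter u.
Λ : Permutation′ n → List ℕ
Λ π = reverse (drop 1 (rsBeforeUs 0 (D π)))

infix 4 _⊆ʸ_ _⊂ʸ_ _⋖_ _<ᴮ_

-- Used only for partitions with the same number of parts (zeros included).
_⊆ʸ_ : List ℕ → List ℕ → Set
_⊆ʸ_ = Pointwise _≤_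

_⊂ʸ_ : List ℕ → List ℕ → Set
μ ⊂ʸ ν = μ ⊆ʸ ν × μ ≢ ν

inversions : List ℕ → ℕ
inversions []      = 0
inversions (x ∷ w) = length (filter (_<? x) w) + inversions w

-- transpose i j ∘ₚ π applies the transposition first, i.e. it exchanges the
-- entries of π in positions i and j.
_⋖_ : Permutation′ n → Permutation′ n → Set
_⋖_ {n} π σ = ∃[ i ] ∃[ j ]
  i <ᶠ j × (π ⟨$⟩ʳ i) <ᶠ (π ⟨$⟩ʳ j)
  × σ ≈ transpose i j ∘ₚ π
  × inversions (word σ) ≡ suc (inversions (word π))

_<ᴮ_ : Permutation′ n → Permutation′ n → Set
_<ᴮ_ = TransClosure _⋖_

{-# OPTIONS --safe #-}

-- In a 1-3-2-avoiding π, no letter larger than v follows a smaller one before v, so the number of r's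
-- before the u of v in D(π) is the length of the longest prefix of π with all letters above v.
-- A covering step cannot shorten any such prefix, which gives Λ(π) ⊆ Λ(σ) when π ≤ σ.  Conversely,
-- let the prefixes of an arbitrary σ be at least those of an avoiding π, and let i be the first
-- position with πᵢ ≠ σᵢ.  Avoidance forces πᵢ < σᵢ, and exchanging σᵢ with the first letter to its
-- right in [πᵢ , σᵢ) is a downward covering step keeping the prefixes long enough.  The chain from
-- σ down to π may leave the 1-3-2-avoiding permutations.

module Submission where

open import Defs
open import Data.Nat.Base using (ℕ; zero; suc; _+_; _≤_; _<_; _>_; _≥_; z≤n; s≤s; s≤s⁻¹)
open import Data.Nat.Properties as ℕ
  using (+-commutativeSemigroup; _≤?_; _<?_; _≟_; ≤-trans; ≤-refl; <-irrefl; <⇒≤; +-assoc; +-suc)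
open import Algebra.Properties.CommutativeSemigroup +-commutativeSemigroup using (x∙yz≈y∙xz)
open import Data.Fin.Base using (Fin; zero; suc; toℕ) renaming (_<_ to _<ᶠ_; _≤_ to _≤ᶠ_)
import Data.Fin.Properties as Fin
open import Data.Fin.Permutation
  using (Permutation′; _⟨$⟩ʳ_; _⟨$⟩ˡ_; inverseʳ; transpose; _∘ₚ_; _≈_)
import Data.Fin.Permutation.Components as PC
open import Data.List.Base
  using (List; []; _∷_; _++_; length; map; filter; drop; reverse; tabulate; takeWhile; dropWhile; applyDownFrom)
open import Data.List.Properties
open import Data.List.Membership.Propositional using (_∈_)
open import Data.List.Relation.Unary.All as All using (All; []; _∷_)
import Data.List.Relation.Unary.All.Properties as All
open import Data.List.Relation.Unary.Any as Any using (Any; here; there)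
open import Data.List.Relation.Unary.AllPairs as AllPairs using (AllPairs; []; _∷_)
import Data.List.Relation.Unary.AllPairs.Properties as AllPairs
import Data.List.Relation.Unary.Unique.Propositional.Properties as Unique
open import Data.List.Relation.Unary.Unique.Propositional using (Unique)
open import Data.List.Relation.Binary.Permutation.Propositional as Perm using (_↭_)
open import Data.List.Relation.Binary.Permutation.Propositional.Properties
  using (All-resp-↭; ↭-length; filter-↭; ++⁺; shift)
open import Data.List.Relation.Binary.Pointwise as Pointwise using (Pointwise; []; _∷_)
open import Data.Product.Base using (_×_; _,_; proj₁; proj₂; ∃-syntax)
open import Data.Sum.Base using (_⊎_; inj₁; inj₂; [_,_]′)
open import Data.Unit.Base using (⊤)
open import Function.Base using (_∘_)
open import Function.Bundles using (_⇔_; mk⇔; Equivalence; Injection)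
open import Function.Properties.Inverse using (↔⇒↣)
open import Level using (Level)
open import Relation.Binary.Construct.Closure.Transitive using ([_]; _∷_; _∷ʳ_)
open import Relation.Binary.Core using (Rel)
open import Relation.Binary.Definitions using (tri<; tri≈; tri>)
open import Relation.Binary.PropositionalEquality
open import Relation.Nullary using (¬_; yes; no; contradiction)
open import Relation.Nullary.Decidable using (dec-true; dec-false; decidable-stable; ¬?; _×-dec_)
open import Relation.Unary using (Pred; Decidable)

private
  variable
    a p q : Level
    A B : Set a
    P : Pred A p
    Q : Pred A q
    n : ℕ

-- Counting and cutting lists.

length-filter-mono : (P? : Decidable P) (Q? : Decidable Q) → (∀ {x} → P x → Q x) →
  ∀ xs → length (filter P? xs) ≤ length (filter Q? xs)
length-filter-mono P? Q? P⇒Q [] = z≤n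
length-filter-mono P? Q? P⇒Q (x ∷ xs) with ih ← length-filter-mono P? Q? P⇒Q xs | P? x | Q? x
... | yes _  | yes _  = s≤s ih
... | yes px | no ¬qx = contradiction (P⇒Q px) ¬qx
... | no _   | yes _  = ℕ.m≤n⇒m≤1+n ih
... | no _   | no _   = ih

length-filter-strict : (P? : Decidable P) (Q? : Decidable Q) → (∀ {x} → P x → Q x) →
  ∀ {xs y} → y ∈ xs → ¬ P y → Q y → length (filter P? xs) < length (filter Q? xs)
length-filter-strict P? Q? P⇒Q {x ∷ xs} (here refl) ¬py qy with P? x | Q? x
... | yes px | _      = contradiction px ¬py
... | no _   | yes _  = s≤s (length-filter-mono P? Q? P⇒Q xs)
... | no _   | no ¬qx = contradiction qy ¬qx
length-filter-strict P? Q? P⇒Q {x ∷ xs} (there y∈xs) ¬py qy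
  with ih ← length-filter-strict P? Q? P⇒Q y∈xs ¬py qy | P? x | Q? x
... | yes _  | yes _  = s≤s ih
... | yes px | no ¬qx = contradiction (P⇒Q px) ¬qx
... | no _   | yes _  = ℕ.m≤n⇒m≤1+n ih
... | no _   | no _   = ih

length-filter-map : (P? : Decidable P) (Q? : Decidable Q) (f : A → B) →
  ∀ {xs} → All (λ x → (P (f x) → Q x) × (Q x → P (f x))) xs →
  length (filter P? (map f xs)) ≡ length (filter Q? xs)
length-filter-map P? Q? f [] = refl
length-filter-map P? Q? f {x ∷ xs} ((to , from) ∷ rest)
  with ih ← length-filter-map P? Q? f rest | P? (f x) | Q? x
... | yes _  | yes _  = cong suc ih
... | yes px | no ¬qx = contradiction (to px) ¬qx
... | no ¬px | yes qx = contradiction (from qx) ¬px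
... | no _   | no _   = ih

takeWhile-++ : (P? : Decidable P) → ∀ {xs} → All P xs →
  ∀ ys → takeWhile P? (xs ++ ys) ≡ xs ++ takeWhile P? ys
takeWhile-++ P? [] ys = refl
takeWhile-++ P? (px ∷ pxs) ys rewrite dec-true (P? _) px = cong (_ ∷_) (takeWhile-++ P? pxs ys)

takeWhile-stop : (P? : Decidable P) → ∀ {xs} → Any (¬_ ∘ P) xs →
  ∀ ys → takeWhile P? (xs ++ ys) ≡ takeWhile P? xs
takeWhile-stop P? (here ¬px) ys rewrite dec-false (P? _) ¬px = refl
takeWhile-stop P? {x ∷ xs} (there s) ys with P? x
... | yes _ = cong (x ∷_) (takeWhile-stop P? s ys)
... | no _  = refl

dropWhile-++ : (P? : Decidable P) → ∀ {xs} → All P xs →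
  ∀ ys → dropWhile P? (xs ++ ys) ≡ dropWhile P? ys
dropWhile-++ P? [] ys = refl
dropWhile-++ P? (px ∷ pxs) ys rewrite dec-true (P? _) px = dropWhile-++ P? pxs ys

AllPairs-++⁻ : {R : Rel A p} → ∀ xs {ys} → AllPairs R (xs ++ ys) →
  AllPairs R xs × AllPairs R ys
AllPairs-++⁻ []       rs       = [] , rs
AllPairs-++⁻ (x ∷ xs) (px ∷ rs) with AllPairs-++⁻ xs rs
... | rxs , rys = All.++⁻ˡ xs px ∷ rxs , rys

-- One unfolding of the path recursion at the largest letter.

leftOf-++ : ∀ {m xs} → All (_≢ m) xs → ∀ ys → leftOf m (xs ++ m ∷ ys) ≡ xs
leftOf-++ {m} {xs} ≢m ys = begin
  leftOf m (xs ++ m ∷ ys)       ≡⟨ takeWhile-++ (λ x → ¬? (x ≟ m)) ≢m (m ∷ ys) ⟩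
  xs ++ leftOf m (m ∷ ys)       ≡⟨ cong (xs ++_) stop ⟩
  xs ++ []                      ≡⟨ ++-identityʳ xs ⟩
  xs                            ∎
  where
  open ≡-Reasoning
  stop : leftOf m (m ∷ ys) ≡ []
  stop rewrite dec-true (m ≟ m) refl = refl

rightOf-++ : ∀ {m xs} → All (_≢ m) xs → ∀ ys → rightOf m (xs ++ m ∷ ys) ≡ ys
rightOf-++ {m} {xs} ≢m ys =
  trans (cong (drop 1) (dropWhile-++ (λ x → ¬? (x ≟ m)) ≢m (m ∷ ys))) stop
  where
  stop : rightOf m (m ∷ ys) ≡ ys
  stop rewrite dec-true (m ≟ m) refl = refl

dyckWithin-++ : ∀ b {m} xs ys → m ≡ length (xs ++ m ∷ ys) → All (_≢ m) xs →
  dyckWithin (suc b) (xs ++ m ∷ ys)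
    ≡ u ∷ dyckWithin b (standardize xs) ++ r ∷ dyckWithin b (standardize ys)
dyckWithin-++ b {m} xs ys m≡ ≢m = begin
  dyckWithin (suc b) w
    ≡⟨ unfold xs ⟩
  u ∷ dyckWithin b (standardize (leftOf (length w) w))
    ++ r ∷ dyckWithin b (standardize (rightOf (length w) w))
    ≡⟨ cong (λ k → u ∷ dyckWithin b (standardize (leftOf k w))
                     ++ r ∷ dyckWithin b (standardize (rightOf k w))) m≡ ⟨
  u ∷ dyckWithin b (standardize (leftOf m w)) ++ r ∷ dyckWithin b (standardize (rightOf m w))
    ≡⟨ cong₂ (λ l s → u ∷ dyckWithin b (standardize l) ++ r ∷ dyckWithin b (standardize s))
             (leftOf-++ ≢m ys) (rightOf-++ ≢m ys) ⟩
  u ∷ dyckWithin b (standardize xs) ++ r ∷ dyckWithin b (standardize ys)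
    ∎
  where
  open ≡-Reasoning
  w = xs ++ m ∷ ys
  -- The clause of `dyckWithin` for nonempty words reduces only once the first letter is exposed,
  -- hence the split on `xs`.
  unfold : ∀ xs → let w = xs ++ m ∷ ys in
    dyckWithin (suc b) w ≡ u ∷ dyckWithin b (standardize (leftOf (length w) w))
                             ++ r ∷ dyckWithin b (standardize (rightOf (length w) w))
  unfold []      = refl
  unfold (_ ∷ _) = refl

-- Ranks and standardization.

rank : List ℕ → ℕ → ℕ
rank w x = length (filter (_≤? x) w)

rank-mono : ∀ w {x y} → x ≤ y → rank w x ≤ rank w y
rank-mono w {x} {y} x≤y = length-filter-mono (_≤? x) (_≤? y) (λ z≤x → ≤-trans z≤x x≤y) w

rank-strict : ∀ {w x y} → y ∈ w → x < y → rank w x < rank w y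
rank-strict {w} {x} {y} y∈w x<y = length-filter-strict (_≤? x) (_≤? y)
  (λ z≤x → ≤-trans z≤x (<⇒≤ x<y)) y∈w (ℕ.<⇒≱ x<y) ≤-refl

-- On the letters of `w` the map `rank w` is strictly increasing, and standardization sees only
-- relative order. Hence a piece of a standardized word standardizes to the same word as the
-- original piece.
standardize-rank : ∀ w {xs} → All (_∈ w) xs → standardize (map (rank w) xs) ≡ standardize xs
standardize-rank w {xs} xs⊆w = trans (sym (map-∘ xs)) (map-cong-local (All.map same xs⊆w))
  where
  same : ∀ {x} → x ∈ w → rank (map (rank w) xs) (rank w x) ≡ rank xs x
  same {x} x∈w = length-filter-map (_≤? rank w x) (_≤? x) (rank w)
    (All.map (λ {y} y∈w → (λ ry≤rx → ℕ.≮⇒≥ λ x<y → ℕ.<⇒≱ (rank-strict y∈w x<y) ry≤rx)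
                        , rank-mono w) xs⊆w)

-- Avoidance in words and the split at the maximum.

-- The recursion peels off the letter playing the 1, so that avoidance passes to the pieces of a
-- word by structural recursion.
Avoids : List ℕ → Set
Avoids []      = ⊤
Avoids (x ∷ w) = AllPairs (λ y z → ¬ (x < z × z < y)) w × Avoids w

-- A letter `x` before `m` and a larger letter `y < m` after it would form the pattern `x`, `m`,
-- `y`; so no letter after `m` exceeds one before it.
Avoids-++⁻ : ∀ xs {m ys} → Avoids (xs ++ m ∷ ys) → All (_< m) ys →
  Avoids xs × Avoids ys × All (λ x → All (_≤ x) ys) xs
Avoids-++⁻ []       (_ , av-ys) ys<m = _ , av-ys , []
Avoids-++⁻ (x ∷ xs) (av-x , av) ys<m
  with Avoids-++⁻ xs av ys<m | AllPairs-++⁻ xs av-x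
... | av-xs , av-ys , ys≤xs | av-x-xs , (av-x-m ∷ _) =
  (av-x-xs , av-xs) , av-ys ,
  All.zipWith (λ (¬132 , y<m) → ℕ.≮⇒≥ λ x<y → ¬132 (x<y , y<m)) (av-x-m , ys<m) ∷ ys≤xs

max-split : ∀ x w → Unique (x ∷ w) →
  ∃[ l ] ∃[ m ] ∃[ s ] x ∷ w ≡ l ++ m ∷ s × All (_< m) l × All (_< m) s
max-split x []      _ = [] , x , [] , refl , [] , []
max-split x (y ∷ w) (x≢ ∷ uniq) with max-split y w uniq
... | l , m , s , eq , l<m , s<m with ℕ.<-cmp x m
...   | tri< x<m _ _ = x ∷ l , m , s , cong (x ∷_) eq , x<m ∷ l<m , s<m
...   | tri≈ _ x≡m _ = contradiction x≡m (All.head (All.++⁻ʳ l (subst (All (x ≢_)) eq x≢)))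
...   | tri> _ _ x>m = [] , x , y ∷ w , refl , [] ,
  subst (All (_< x)) (sym eq)
    (All.++⁺ (All.map (λ z<m → ℕ.<-trans z<m x>m) l<m)
             (x>m ∷ All.map (λ z<m → ℕ.<-trans z<m x>m) s<m))

-- Runs of large letters and the counts along the path.

-- For a word avoiding 1-3-2 this is the number of all larger letters before v,
-- since no larger letter follows a smaller one before v.
runAbove : List ℕ → ℕ → ℕ
runAbove w v = length (takeWhile (v <?_) w)

-- The run ends at `v` itself at the latest, so letters appended after `v` cannot lengthen it.
runAbove-stop : ∀ {v xs} → v ∈ xs → ∀ ys → runAbove (xs ++ ys) v ≡ runAbove xs v
runAbove-stop {v} v∈xs ys =
  cong length (takeWhile-stop (v <?_) (Any.map (λ { refl → <-irrefl refl }) v∈xs) ys)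

runAbove-++ : ∀ {v xs} → All (v <_) xs → ∀ ys → runAbove (xs ++ ys) v ≡ length xs + runAbove ys v
runAbove-++ {v} {xs} v<xs ys =
  trans (cong length (takeWhile-++ (v <?_) v<xs ys)) (length-++ xs)

-- The up steps of `d` correspond, in order, to the letters of `w` in decreasing order. The start
-- count `c` and the continuation `t` make the property compose under concatenation; passing to
-- `c + length w` records that `d` has one right step per letter.
DyckProfile : List ℕ → List Step → Set
DyckProfile w d = ∃[ s ] s ↭ w × AllPairs _>_ s ×
  (∀ c t → rsBeforeUs c (d ++ t) ≡ map (λ x → c + runAbove w x) s ++ rsBeforeUs (c + length w) t)

empty-profile : DyckProfile [] []
empty-profile = [] , Perm.↭-refl , [] , λ c t → cong (λ k → rsBeforeUs k t) (sym (ℕ.+-identityʳ c))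

-- Since the letters of `s` lie below those of `l`, the order `m`, then `l`, then `s` is decreasing.
-- Runs for letters of `l` end inside `l`; runs for letters of `s` pass all of `l` and `m`, matching
-- the right steps of `d` and the `r` after it.
join-profile : ∀ {l m s d e} → All (_< m) l → All (_< m) s → All (λ x → All (_< x) s) l →
  DyckProfile l d → DyckProfile s e → DyckProfile (l ++ m ∷ s) (u ∷ d ++ r ∷ e)
join-profile {l} {m} {s} {d} {e} l<m s<m s<l (lˢ , lˢ↭l , l> , eqˡ) (sˢ , sˢ↭s , s> , eqˢ) =
  m ∷ lˢ ++ sˢ
  , Perm.trans (Perm.prep m (++⁺ lˢ↭l sˢ↭s)) (Perm.↭-sym (shift m l s))
  , All.++⁺ (All-resp-↭ (Perm.↭-sym lˢ↭l) l<m) (All-resp-↭ (Perm.↭-sym sˢ↭s) s<m)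
    ∷ AllPairs.++⁺ l> s> (All-resp-↭ (Perm.↭-sym lˢ↭l) (All.map (All-resp-↭ (Perm.↭-sym sˢ↭s)) s<l))
  , eq
  where
  open ≡-Reasoning
  w = l ++ m ∷ s

  run-m : runAbove w m ≡ 0
  run-m = stop l l<m
    where
    stop : ∀ l → All (_< m) l → runAbove (l ++ m ∷ s) m ≡ 0
    stop []      _           rewrite dec-false (m <? m) (<-irrefl refl) = refl
    stop (x ∷ _) (x<m ∷ _)   rewrite dec-false (m <? x) (ℕ.<-asym x<m) = refl

  run-l : All (λ x → runAbove w x ≡ runAbove l x) lˢ
  run-l = All-resp-↭ (Perm.↭-sym lˢ↭l) (All.tabulate λ x∈l → runAbove-stop x∈l (m ∷ s))

  run-s : All (λ x → runAbove w x ≡ suc (length l + runAbove s x)) sˢ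
  run-s = All-resp-↭ (Perm.↭-sym sˢ↭s) (All.tabulate λ {x} x∈s → begin
    runAbove w x                     ≡⟨ runAbove-++ (All.map (λ z → All.lookup z x∈s) s<l) (m ∷ s) ⟩
    length l + runAbove (m ∷ s) x
      ≡⟨ cong (length l +_) (runAbove-++ (All.lookup s<m x∈s ∷ []) s) ⟩
    length l + suc (runAbove s x)    ≡⟨ +-suc (length l) _ ⟩
    suc (length l + runAbove s x)    ∎)

  eq : ∀ c t → rsBeforeUs c (u ∷ (d ++ r ∷ e) ++ t) ≡
    (c + runAbove w m) ∷ map (λ x → c + runAbove w x) (lˢ ++ sˢ) ++ rsBeforeUs (c + length w) t
  eq c t = cong₂ _∷_ (sym (trans (cong (c +_) run-m) (ℕ.+-identityʳ c))) (begin
    rsBeforeUs c ((d ++ r ∷ e) ++ t)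
      ≡⟨ cong (rsBeforeUs c) (++-assoc d (r ∷ e) t) ⟩
    rsBeforeUs c (d ++ r ∷ e ++ t)
      ≡⟨ eqˡ c (r ∷ e ++ t) ⟩
    map (λ x → c + runAbove l x) lˢ ++ rsBeforeUs (suc (c + length l)) (e ++ t)
      ≡⟨ cong (map (λ x → c + runAbove l x) lˢ ++_) (eqˢ (suc (c + length l)) t) ⟩
    map (λ x → c + runAbove l x) lˢ ++ map (λ x → suc (c + length l) + runAbove s x) sˢ
      ++ rsBeforeUs (suc (c + length l) + length s) t
      ≡⟨ cong₂ _++_
           (map-cong-local (All.map (λ q → cong (c +_) (sym q)) run-l))
           (cong₂ _++_
             (map-cong-local (All.map (λ q → trans (assoc c _) (cong (c +_) (sym q))) run-s))
             (cong (λ k → rsBeforeUs k t)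
               (trans (assoc c (length s)) (cong (c +_) (sym length-w))))) ⟩
    map (λ x → c + runAbove w x) lˢ ++ map (λ x → c + runAbove w x) sˢ
      ++ rsBeforeUs (c + length w) t
      ≡⟨ ++-assoc (map _ lˢ) (map _ sˢ) _ ⟨
    (map (λ x → c + runAbove w x) lˢ ++ map (λ x → c + runAbove w x) sˢ)
      ++ rsBeforeUs (c + length w) t
      ≡⟨ cong (_++ rsBeforeUs (c + length w) t) (map-++ _ lˢ sˢ) ⟨
    map (λ x → c + runAbove w x) (lˢ ++ sˢ) ++ rsBeforeUs (c + length w) t
      ∎)
    where
    assoc : ∀ c k → suc (c + length l) + k ≡ c + suc (length l + k)
    assoc c k = trans (cong suc (+-assoc c (length l) k)) (sym (+-suc c _))
    length-w : length w ≡ suc (length l + length s)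
    length-w = trans (length-++ l) (+-suc (length l) (length s))

-- Induction along the split at the largest letter. The path is that of `standardize w` because the
-- recursion standardizes each piece afresh, while the profile keeps the original letters so that
-- the two pieces can be compared when joined.
dyck-profile : ∀ b w → length w ≤ b → Unique w → Avoids w →
  DyckProfile w (dyckWithin b (standardize w))
dyck-profile zero    []      _ _ _ = empty-profile
dyck-profile (suc b) []      _ _ _ = empty-profile
dyck-profile (suc b) w@(x ∷ w′) len uniq av with max-split x w′ uniq
... | l , m , s , eq , l<m , s<m =
  subst₂ DyckProfile (sym eq) (sym path) (join-profile {d = dyckWithin b (standardize l)} {e = dyckWithin b (standardize s)} l<m s<m s<l
    (dyck-profile b l (≤-trans (ℕ.m≤m+n _ _) len′) (proj₁ uniqs) (proj₁ avs))
    (dyck-profile b s (≤-trans (ℕ.m≤n+m _ _) len′) (AllPairs.tail (proj₂ uniqs)) (proj₁ (proj₂ avs))))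
  where
  open ≡-Reasoning
  v = l ++ m ∷ s

  len′ : length l + length s ≤ b
  len′ = s≤s⁻¹ (subst (_≤ suc b)
    (trans (cong length eq) (trans (length-++ l) (+-suc (length l) (length s)))) len)

  uniqs : Unique l × Unique (m ∷ s)
  uniqs = AllPairs-++⁻ l (subst Unique eq uniq)

  avs = Avoids-++⁻ l (subst Avoids eq av) s<m

  cross : ∀ l {s} → Unique (l ++ m ∷ s) → All (λ x → All (_≤ x) s) l → All (λ x → All (_< x) s) l
  cross []      _ _ = []
  cross (y ∷ l) (y≢ ∷ un) (≤y ∷ rest) =
    All.zipWith (λ (z≤y , y≢z) → ℕ.≤∧≢⇒< z≤y (y≢z ∘ sym)) (≤y , All.tail (All.++⁻ʳ l y≢))
    ∷ cross l un rest

  s<l : All (λ x → All (_< x) s) l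
  s<l = cross l (subst Unique eq uniq) (proj₂ (proj₂ avs))

  all≤m : All (_≤ m) v
  all≤m = All.++⁺ (All.map <⇒≤ l<m) (≤-refl ∷ All.map <⇒≤ s<m)

  -- Standardization sends the maximum to the length of the word, which is the letter at which
  -- `dyckWithin` splits.
  rank-m : rank v m ≡ length v
  rank-m = cong length (filter-all (_≤? m) all≤m)

  pieces : standardize v ≡ map (rank v) l ++ rank v m ∷ map (rank v) s
  pieces = map-++ (rank v) l (m ∷ s)

  ⊆v : All (_∈ v) v
  ⊆v = All.tabulate (λ z → z)

  m∈v : m ∈ v
  m∈v = All.head (All.++⁻ʳ l ⊆v)

  path : dyckWithin (suc b) (standardize w)
    ≡ u ∷ dyckWithin b (standardize l) ++ r ∷ dyckWithin b (standardize s)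
  path = begin
    dyckWithin (suc b) (standardize w)
      ≡⟨ cong (dyckWithin (suc b) ∘ standardize) eq ⟩
    dyckWithin (suc b) (standardize v)
      ≡⟨ cong (dyckWithin (suc b)) pieces ⟩
    dyckWithin (suc b) (map (rank v) l ++ rank v m ∷ map (rank v) s)
      ≡⟨ dyckWithin-++ b (map (rank v) l) (map (rank v) s)
           (trans rank-m (trans (sym (length-map (rank v) v)) (cong length pieces)))
           (All.map⁺ (All.map (λ x<m → ℕ.<⇒≢ (rank-strict m∈v x<m)) l<m)) ⟩
    u ∷ dyckWithin b (standardize (map (rank v) l)) ++ r ∷ dyckWithin b (standardize (map (rank v) s))
      ≡⟨ cong₂ (λ x y → u ∷ dyckWithin b x ++ r ∷ dyckWithin b y)
           (standardize-rank v (All.++⁻ˡ l ⊆v))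
           (standardize-rank v (All.tail (All.++⁻ʳ l ⊆v))) ⟩
    u ∷ dyckWithin b (standardize l) ++ r ∷ dyckWithin b (standardize s)
      ∎

-- From words to permutations.

letter : Permutation′ n → Fin n → ℕ
letter π i = suc (toℕ (π ⟨$⟩ʳ i))

letter-injective : (π : Permutation′ n) → ∀ {i j} → letter π i ≡ letter π j → i ≡ j
letter-injective π = Injection.injective (↔⇒↣ π) ∘ Fin.toℕ-injective ∘ ℕ.suc-injective

Avoids-tabulate⁺ : {f : Fin n → ℕ} →
  (∀ i j k → i <ᶠ j → j <ᶠ k → ¬ (f i < f k × f k < f j)) → Avoids (tabulate f)
Avoids-tabulate⁺ {zero}  _  = _
Avoids-tabulate⁺ {suc n} av =
  AllPairs.tabulate⁺-< (λ {j} {k} j<k → av zero (suc j) (suc k) (s≤s z≤n) (s≤s j<k))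
  , Avoids-tabulate⁺ (λ i j k i<j j<k → av (suc i) (suc j) (suc k) (s≤s i<j) (s≤s j<k))

Avoids132⇒Avoids : (π : Permutation′ n) → Avoids132 π → Avoids (word π)
Avoids132⇒Avoids π av = Avoids-tabulate⁺ λ i j k i<j j<k (i<k , k<j) →
  av i j k i<j j<k (s≤s⁻¹ i<k , s≤s⁻¹ k<j)

length<head : ∀ {x s} → AllPairs _>_ (x ∷ s) → All (0 <_) (x ∷ s) → length s < x
length<head {s = []}    _                   (0<x ∷ _)  = 0<x
length<head {s = _ ∷ _} ((y<x ∷ _) ∷ s>) (_ ∷ 0<s) = ℕ.≤-<-trans (length<head s> 0<s) y<x

-- The head is at least the length by `length<head` and at most the bound, so it is forced; strict
-- descent then bounds the tail by one less.
descending-unique : ∀ n {s} → AllPairs _>_ s → All (0 <_) s → All (_≤ n) s → length s ≡ n →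
  s ≡ applyDownFrom suc n
descending-unique zero    {[]}    _ _ _ _ = refl
descending-unique (suc n) {x ∷ s} x>@(s<x ∷ s>) 0<x@(_ ∷ 0<s) (x≤n ∷ _) len = cong₂ _∷_
  (ℕ.≤-antisym x≤n (subst (_≤ x) len (length<head x> 0<x)))
  (descending-unique n s> 0<s (All.map (λ y<x → s≤s⁻¹ (ℕ.<-≤-trans y<x x≤n)) s<x)
    (ℕ.suc-injective len))

rank-applyDownFrom : ∀ n {x} → x ≤ n → rank (applyDownFrom suc n) x ≡ x
rank-applyDownFrom zero    z≤n = refl
rank-applyDownFrom (suc n) {x} x≤n with x ≟ suc n
... | yes refl = trans
  (cong length (filter-all (_≤? suc n) (All.applyDownFrom⁺₁ suc (suc n) (λ i<n → i<n))))
  (length-applyDownFrom suc (suc n))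
... | no x≢n = trans (cong length (filter-reject (_≤? x) (ℕ.<⇒≱ x<n)))
  (rank-applyDownFrom n (s≤s⁻¹ x<n))
  where x<n = ℕ.≤∧≢⇒< x≤n x≢n

rsBeforeUs-D : (π : Permutation′ n) → Avoids132 π →
  rsBeforeUs 0 (D π) ≡ map (runAbove (word π)) (applyDownFrom suc n)
rsBeforeUs-D {n} π av
  with dyck-profile (length (word π)) (word π) ≤-refl
         (Unique.tabulate⁺ (letter-injective π)) (Avoids132⇒Avoids π av)
... | s , s↭w , s> , eq = begin
  rsBeforeUs 0 (dyckWithin k w)                            ≡⟨ cong (rsBeforeUs 0 ∘ dyckWithin k) standard ⟨
  rsBeforeUs 0 (dyckWithin k (standardize w))              ≡⟨ cong (rsBeforeUs 0) (++-identityʳ (dyckWithin k (standardize w))) ⟨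
  rsBeforeUs 0 (dyckWithin k (standardize w) ++ [])        ≡⟨ eq 0 [] ⟩
  map (runAbove w) s ++ []                                 ≡⟨ ++-identityʳ _ ⟩
  map (runAbove w) s                                       ≡⟨ cong (map (runAbove w)) s≡ ⟩
  map (runAbove w) (applyDownFrom suc n)                   ∎
  where
  open ≡-Reasoning
  w = word π
  k = length w

  w≤n : All (_≤ n) w
  w≤n = All.tabulate⁺ (λ i → Fin.toℕ<n (π ⟨$⟩ʳ i))

  s≡ : s ≡ applyDownFrom suc n
  s≡ = descending-unique n s>
    (All-resp-↭ (Perm.↭-sym s↭w) (All.tabulate⁺ (λ _ → s≤s z≤n)))
    (All-resp-↭ (Perm.↭-sym s↭w) w≤n)
    (trans (↭-length s↭w) (length-tabulate _))

  -- `D` starts from the word itself, `dyck-profile` from its standardization. They agree because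
  -- `w` rearranges the letters from `n` down to 1, and ranks ignore order.
  standard : standardize w ≡ w
  standard = trans (map-cong-local (All.map (λ {x} x≤n → trans
      (↭-length (filter-↭ (_≤? x) (subst (w ↭_) s≡ (Perm.↭-sym s↭w))))
      (rank-applyDownFrom n x≤n)) w≤n))
    (map-id w)

-- Containment of diagrams as a condition on positions.

-- It is enough to conclude at k alone: the hypothesis passes to all smaller positions.
RunsExtend : (f g : Fin n → ℕ) → Set
RunsExtend f g = ∀ v k → (∀ a → a ≤ᶠ k → v < f a) → v < g k

RunsExtend-trans : {f g h : Fin n → ℕ} → RunsExtend f g → RunsExtend g h → RunsExtend f h
RunsExtend-trans fg gh v k v<f =
  gh v k λ a a≤k → fg v a λ b b≤a → v<f b (≤-trans b≤a a≤k)

takeWhile-tabulate-mono : (P? : Decidable P) {f g : Fin n → A} →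
  (∀ k → (∀ a → a ≤ᶠ k → P (f a)) → P (g k)) →
  length (takeWhile P? (tabulate f)) ≤ length (takeWhile P? (tabulate g))
takeWhile-tabulate-mono {n = zero}  P? ext = z≤n
takeWhile-tabulate-mono {n = suc n} P? {f} {g} ext with P? (f zero)
... | no _   = z≤n
... | yes p₀ with P? (g zero)
...   | yes _  = s≤s (takeWhile-tabulate-mono P? λ k h →
        ext (suc k) λ { zero _ → p₀ ; (suc a) a≤k → h a (s≤s⁻¹ a≤k) })
...   | no ¬q₀ = contradiction (ext zero λ { zero _ → p₀ }) ¬q₀

takeWhile-tabulate-mono⁻ : (P? : Decidable P) {f g : Fin n → A} →
  length (takeWhile P? (tabulate f)) ≤ length (takeWhile P? (tabulate g)) →
  ∀ k → (∀ a → a ≤ᶠ k → P (f a)) → P (g k)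
takeWhile-tabulate-mono⁻ {n = suc n} P? {f} {g} len k h with P? (f zero) | P? (g zero)
takeWhile-tabulate-mono⁻ {n = suc n} P? len k h | no ¬p₀ | _ = contradiction (h zero z≤n) ¬p₀
takeWhile-tabulate-mono⁻ {n = suc n} P? () k h | yes _ | no _
takeWhile-tabulate-mono⁻ {n = suc n} P? len zero    h | yes _ | yes q₀ = q₀
takeWhile-tabulate-mono⁻ {n = suc n} P? len (suc k) h | yes _ | yes q₀ =
  takeWhile-tabulate-mono⁻ P? (s≤s⁻¹ len) k λ a a≤k → h (suc a) (s≤s a≤k)

Pointwise-map⁺ : {R : Rel B p} {f g : A → B} → ∀ xs → All (λ x → R (f x) (g x)) xs →
  Pointwise R (map f xs) (map g xs)
Pointwise-map⁺ []       []         = []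
Pointwise-map⁺ (x ∷ xs) (px ∷ pxs) = px ∷ Pointwise-map⁺ xs pxs

Pointwise-map⁻ : {R : Rel B p} {f g : A → B} → ∀ xs → Pointwise R (map f xs) (map g xs) →
  All (λ x → R (f x) (g x)) xs
Pointwise-map⁻ []       []       = []
Pointwise-map⁻ (x ∷ xs) (fx∼gx ∷ rest) = fx∼gx ∷ Pointwise-map⁻ xs rest

Λ-RunsExtend : (π σ : Permutation′ (suc n)) → Avoids132 π → Avoids132 σ →
  (Λ π ⊆ʸ Λ σ) ⇔ RunsExtend (letter π) (letter σ)
Λ-RunsExtend {n} π σ av-π av-σ = mk⇔ to from
  where
  parts : Permutation′ (suc n) → List ℕ
  parts ρ = map (runAbove (word ρ)) (applyDownFrom suc n)

  Λ≡ : ∀ ρ → Avoids132 ρ → Λ ρ ≡ reverse (parts ρ)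
  -- The list `applyDownFrom suc (suc n)` begins with the largest letter, whose count is the one
  -- that `drop 1` discards.
  Λ≡ ρ av = cong (reverse ∘ drop 1) (rsBeforeUs-D ρ av)

  from : RunsExtend (letter π) (letter σ) → Λ π ⊆ʸ Λ σ
  from ext = subst₂ _⊆ʸ_ (sym (Λ≡ π av-π)) (sym (Λ≡ σ av-σ))
    (Pointwise.reverse⁺ (Pointwise-map⁺ (applyDownFrom suc n)
      (All.tabulate λ {v} _ → takeWhile-tabulate-mono (v <?_) (ext v))))

  shorter : Λ π ⊆ʸ Λ σ → All (λ v → runAbove (word π) v ≤ runAbove (word σ) v) (applyDownFrom suc n)
  shorter Λ≤ = Pointwise-map⁻ (applyDownFrom suc n)
    (subst₂ _⊆ʸ_ (reverse-involutive (parts π)) (reverse-involutive (parts σ))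
      (Pointwise.reverse⁺ (subst₂ _⊆ʸ_ (Λ≡ π av-π) (Λ≡ σ av-σ) Λ≤)))

  ∈-applyDownFrom : ∀ {v k} → v < k → suc v ∈ applyDownFrom suc k
  ∈-applyDownFrom {v} {suc k} v<k with v ≟ k
  ... | yes refl = here refl
  ... | no v≢k   = there (∈-applyDownFrom (ℕ.≤∧≢⇒< (s≤s⁻¹ v<k) v≢k))

  to : Λ π ⊆ʸ Λ σ → RunsExtend (letter π) (letter σ)
  -- Parts exist only for the values 1 to `n`. The value 0 lies below every letter, and any other
  -- value is at most `n` because `h k` puts it below a letter of `π`.
  to Λ≤ zero    k _ = s≤s z≤n
  to Λ≤ (suc v) k h = takeWhile-tabulate-mono⁻ (suc v <?_) {letter π} {letter σ}
    (All.lookup (shorter Λ≤) (∈-applyDownFrom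
      (s≤s⁻¹ (≤-trans (h k ≤-refl) (Fin.toℕ<n (π ⟨$⟩ʳ k))))))
    k h

-- Transpositions and upward Bruhat steps.

transpose-ˡ : (i j : Fin n) → PC.transpose i j i ≡ j
transpose-ˡ i j rewrite dec-true (i Fin.≟ i) refl = refl

transpose-ʳ : (i j : Fin n) → PC.transpose i j j ≡ i
transpose-ʳ i j with j Fin.≟ i
... | yes j≡i = j≡i
... | no _ rewrite dec-true (j Fin.≟ j) refl = refl

transpose-fix : {i j k : Fin n} → k ≢ i → k ≢ j → PC.transpose i j k ≡ k
transpose-fix {i = i} {j} {k} k≢i k≢j
  rewrite dec-false (k Fin.≟ i) k≢i | dec-false (k Fin.≟ j) k≢j = refl

data TransposeView (i j : Fin n) : Fin n → Set where
  left  : TransposeView i j i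
  right : TransposeView i j j
  fixed : ∀ {k} → k ≢ i → k ≢ j → TransposeView i j k

transposeView : (i j k : Fin n) → TransposeView i j k
transposeView i j k with k Fin.≟ i | k Fin.≟ j
... | yes refl | _        = left
... | no _     | yes refl = right
... | no k≢i   | no k≢j   = fixed k≢i k≢j

transpose-involutive : (i j k : Fin n) → PC.transpose i j (PC.transpose i j k) ≡ k
transpose-involutive i j k with transposeView i j k
... | left          = trans (cong (PC.transpose i j) (transpose-ˡ i j)) (transpose-ʳ i j)
... | right         = trans (cong (PC.transpose i j) (transpose-ʳ i j)) (transpose-ˡ i j)
... | fixed k≢i k≢j = trans (cong (PC.transpose i j) (transpose-fix k≢i k≢j)) (transpose-fix k≢i k≢j)

-- The entry at `i` grows, and `j` receives the old entry of `i`, an earlier position contained in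
-- every prefix that reaches `j`.
⋖⇒RunsExtend : {π σ : Permutation′ n} → π ⋖ σ → RunsExtend (letter π) (letter σ)
⋖⇒RunsExtend {π = π} {σ} (i , j , i<j , πi<πj , σ≈ , _) v k v<π = subst (v <_) (sym σk) step
  where
  σk : letter σ k ≡ letter π (PC.transpose i j k)
  σk = cong (suc ∘ toℕ) (σ≈ k)
  step : v < letter π (PC.transpose i j k)
  step with transposeView i j k
  ... | left  = subst (λ z → v < letter π z) (sym (transpose-ˡ i j)) (ℕ.<-trans (v<π i ≤-refl) (s≤s πi<πj))
  ... | right = subst (λ z → v < letter π z) (sym (transpose-ʳ i j)) (v<π i (<⇒≤ i<j))
  ... | fixed k≢i k≢j = subst (λ z → v < letter π z) (sym (transpose-fix k≢i k≢j)) (v<π k ≤-refl)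

<ᴮ⇒RunsExtend : {π σ : Permutation′ n} → π <ᴮ σ → RunsExtend (letter π) (letter σ)
<ᴮ⇒RunsExtend {π = π} {σ} [ π⋖σ ] = ⋖⇒RunsExtend {π = π} {σ} π⋖σ
<ᴮ⇒RunsExtend {π = π} {σ} (_∷_ {y = ρ} π⋖ρ ρ<σ) =
  RunsExtend-trans (⋖⇒RunsExtend {π = π} {ρ} π⋖ρ) (<ᴮ⇒RunsExtend ρ<σ)

<ᴮ⇒inversions< : {π σ : Permutation′ n} → π <ᴮ σ → inversions (word π) < inversions (word σ)
<ᴮ⇒inversions< [ _ , _ , _ , _ , _ , inv ]         = ℕ.≤-reflexive (sym inv)
<ᴮ⇒inversions< ((_ , _ , _ , _ , _ , inv) ∷ ρ<σ) =
  ℕ.<-trans (ℕ.≤-reflexive (sym inv)) (<ᴮ⇒inversions< ρ<σ)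

word-cong : {π σ : Permutation′ n} → π ≈ σ → word π ≡ word σ
word-cong π≈σ = tabulate-cong (cong (suc ∘ toℕ) ∘ π≈σ)

-- A descending chain ends at a permutation known only to agree with `π` pointwise; this moves its
-- last step to `π` itself.
⋖-respˡ-≈ : {π ρ σ : Permutation′ n} → π ≈ ρ → ρ ⋖ σ → π ⋖ σ
⋖-respˡ-≈ {π = π} {ρ} π≈ρ (i , j , i<j , ρi<ρj , σ≈ , inv) =
  i , j , i<j , subst₂ _<ᶠ_ (sym (π≈ρ i)) (sym (π≈ρ j)) ρi<ρj
  , (λ k → trans (σ≈ k) (sym (π≈ρ _)))
  , trans inv (cong (suc ∘ inversions) (sym (word-cong {π = π} {ρ} π≈ρ)))

-- Inversion counts under an exchange of two letters.

below : ℕ → List ℕ → ℕ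
below x w = length (filter (_<? x) w)

below-accept : ∀ {x y w} → y < x → below x (y ∷ w) ≡ suc (below x w)
below-accept {x} y<x = cong length (filter-accept (_<? x) y<x)

below-reject : ∀ {x y w} → ¬ y < x → below x (y ∷ w) ≡ below x w
below-reject {x} y≮x = cong length (filter-reject (_<? x) y≮x)

below-++ : ∀ b xs ys → below b (xs ++ ys) ≡ below b xs + below b ys
below-++ b xs ys = trans (cong length (filter-++ (_<? b) xs ys)) (length-++ (filter (_<? b) xs))

-- A letter `b` between the two positions is below both `x` and `y` or above both, so its inversions
-- with the pair keep their number. Only the pair itself gains or loses an inversion.
inversions-exchange-head : ∀ {x y} → x < y → ∀ {ys} → All (λ b → b < x ⊎ y < b) ys → ∀ zs →
  inversions (y ∷ ys ++ x ∷ zs) ≡ suc (inversions (x ∷ ys ++ y ∷ zs))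
inversions-exchange-head {x} {y} x<y [] zs = begin
  below y (x ∷ zs) + (below x zs + inversions zs)
    ≡⟨ cong (_+ (below x zs + inversions zs)) (below-accept x<y) ⟩
  suc (below y zs + (below x zs + inversions zs))
    ≡⟨ cong suc (x∙yz≈y∙xz (below y zs) (below x zs) (inversions zs)) ⟩
  suc (below x zs + (below y zs + inversions zs))
    ≡⟨ cong (λ k → suc (k + (below y zs + inversions zs))) (below-reject (ℕ.<-asym x<y)) ⟨
  suc (below x (y ∷ zs) + (below y zs + inversions zs))
    ∎
  where open ≡-Reasoning
inversions-exchange-head {x} {y} x<y {b ∷ ys} (outside ∷ rest) zs = [ small , large ]′ outside
  where
  open ≡-Reasoning
  T  = ys ++ x ∷ zs
  T′ = ys ++ y ∷ zs
  ih = inversions-exchange-head x<y rest zs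

  same-below : below b (x ∷ zs) ≡ below b (y ∷ zs) → below b T ≡ below b T′
  same-below eq = trans (below-++ b ys (x ∷ zs))
    (trans (cong (below b ys +_) eq) (sym (below-++ b ys (y ∷ zs))))

  regroup : below b T ≡ below b T′ →
    below y T + (below b T + inversions T) ≡ suc (below x T′ + (below b T′ + inversions T′))
  regroup eq = begin
    below y T + (below b T + inversions T)            ≡⟨ x∙yz≈y∙xz (below y T) (below b T) _ ⟩
    below b T + (below y T + inversions T)            ≡⟨ cong₂ _+_ eq ih ⟩
    below b T′ + suc (below x T′ + inversions T′)     ≡⟨ +-suc (below b T′) _ ⟩
    suc (below b T′ + (below x T′ + inversions T′))   ≡⟨ cong suc (x∙yz≈y∙xz (below b T′) (below x T′) _) ⟩
    suc (below x T′ + (below b T′ + inversions T′))   ∎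

  small : b < x → inversions (y ∷ b ∷ T) ≡ suc (inversions (x ∷ b ∷ T′))
  small b<x = begin
    below y (b ∷ T) + (below b T + inversions T)
      ≡⟨ cong (_+ (below b T + inversions T)) (below-accept b<y) ⟩
    suc (below y T + (below b T + inversions T))
      ≡⟨ cong suc (regroup (same-below (trans (below-reject (ℕ.<-asym b<x))
                                              (sym (below-reject (ℕ.<-asym b<y)))))) ⟩
    suc (suc (below x T′ + (below b T′ + inversions T′)))
      ≡⟨ cong (λ k → suc (k + (below b T′ + inversions T′))) (below-accept b<x) ⟨
    suc (below x (b ∷ T′) + (below b T′ + inversions T′))
      ∎
    where b<y = ℕ.<-trans b<x x<y

  large : y < b → inversions (y ∷ b ∷ T) ≡ suc (inversions (x ∷ b ∷ T′))
  large y<b = begin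
    below y (b ∷ T) + (below b T + inversions T)
      ≡⟨ cong (_+ (below b T + inversions T)) (below-reject (ℕ.<-asym y<b)) ⟩
    below y T + (below b T + inversions T)
      ≡⟨ regroup (same-below (trans (below-accept x<b) (sym (below-accept y<b)))) ⟩
    suc (below x T′ + (below b T′ + inversions T′))
      ≡⟨ cong (λ k → suc (k + (below b T′ + inversions T′))) (below-reject (ℕ.<-asym x<b)) ⟨
    suc (below x (b ∷ T′) + (below b T′ + inversions T′))
      ∎
    where x<b = ℕ.<-trans x<y y<b

exchange-↭ : ∀ {x y : A} ys {zs} → y ∷ ys ++ x ∷ zs ↭ x ∷ ys ++ y ∷ zs
exchange-↭ {x = x} {y} ys {zs} =
  Perm.trans (Perm.prep y (shift x ys zs))
    (Perm.trans (Perm.swap y x Perm.refl) (Perm.prep x (Perm.↭-sym (shift y ys zs))))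

-- A letter of the common prefix `xs` is followed by the same letters up to order, so its count does
-- not change.
inversions-exchange : ∀ {x y} → x < y → ∀ xs {ys} → All (λ b → b < x ⊎ y < b) ys → ∀ zs →
  inversions (xs ++ y ∷ ys ++ x ∷ zs) ≡ suc (inversions (xs ++ x ∷ ys ++ y ∷ zs))
inversions-exchange x<y []       outside zs = inversions-exchange-head x<y outside zs
inversions-exchange x<y (a ∷ xs) {ys} outside zs = trans
  (cong₂ _+_ (↭-length (filter-↭ (_<? a) (++⁺ (Perm.refl {xs = xs}) (exchange-↭ ys))))
             (inversions-exchange x<y xs outside zs))
  (+-suc _ _)

-- Exchanges of entries as covering steps.

-- The situation in `tabulate-exchange` once its left position has been peeled off: one differing
-- position remains.
tabulate-update : (f g : Fin n → A) → ∀ j → (∀ {a} → a ≢ j → g a ≡ f a) → (∀ {a} → a <ᶠ j → P (f a)) →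
  ∃[ xs ] ∃[ ys ] tabulate f ≡ xs ++ f j ∷ ys × tabulate g ≡ xs ++ g j ∷ ys × All P xs
tabulate-update f g zero    g≡f _ =
  [] , _ , refl , cong (g zero ∷_) (tabulate-cong (λ a → g≡f (λ ()))) , []
tabulate-update f g (suc j) g≡f pf
  with tabulate-update (f ∘ suc) (g ∘ suc) j (λ a≢j → g≡f (a≢j ∘ Fin.suc-injective)) (pf ∘ s≤s)
... | xs , ys , eqᶠ , eqᵍ , pxs =
  f zero ∷ xs , ys , cong (f zero ∷_) eqᶠ , cong₂ _∷_ (g≡f (λ ())) eqᵍ , pf (s≤s z≤n) ∷ pxs

tabulate-exchange : (f g : Fin n → A) → ∀ i j → i <ᶠ j →
  g i ≡ f j → g j ≡ f i → (∀ {a} → a ≢ i → a ≢ j → g a ≡ f a) →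
  (∀ {a} → i <ᶠ a → a <ᶠ j → P (f a)) →
  ∃[ xs ] ∃[ ys ] ∃[ zs ] tabulate f ≡ xs ++ f i ∷ ys ++ f j ∷ zs
    × tabulate g ≡ xs ++ f j ∷ ys ++ f i ∷ zs × All P ys
tabulate-exchange f g zero (suc j) _ gi gj g≡f pf
  with tabulate-update (f ∘ suc) (g ∘ suc) j (λ a≢j → g≡f (λ ()) (a≢j ∘ Fin.suc-injective))
         (λ a<j → pf (s≤s z≤n) (s≤s a<j))
... | ys , zs , eqᶠ , eqᵍ , pys =
  [] , ys , zs , cong (f zero ∷_) eqᶠ
  , cong₂ _∷_ gi (trans eqᵍ (cong (λ z → ys ++ z ∷ zs) gj)) , pys
tabulate-exchange f g (suc i) (suc j) i<j gi gj g≡f pf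
  with tabulate-exchange (f ∘ suc) (g ∘ suc) i j (s≤s⁻¹ i<j) gi gj
         (λ a≢i a≢j → g≡f (a≢i ∘ Fin.suc-injective) (a≢j ∘ Fin.suc-injective))
         (λ i<a a<j → pf (s≤s i<a) (s≤s a<j))
... | xs , ys , zs , eqᶠ , eqᵍ , pys =
  f zero ∷ xs , ys , zs , cong (f zero ∷_) eqᶠ , cong₂ _∷_ (g≡f (λ ()) (λ ())) eqᵍ , pys

transpose-⋖ : (σ : Permutation′ n) → ∀ {i j} → i <ᶠ j → letter σ j < letter σ i →
  (∀ {a} → i <ᶠ a → a <ᶠ j → letter σ a < letter σ j ⊎ letter σ i < letter σ a) →
  transpose i j ∘ₚ σ ⋖ σ
transpose-⋖ σ {i} {j} i<j σj<σi outside =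
  i , j , i<j
  , subst₂ (λ a b → (σ ⟨$⟩ʳ a) <ᶠ (σ ⟨$⟩ʳ b)) (sym (transpose-ˡ i j)) (sym (transpose-ʳ i j)) (s≤s⁻¹ σj<σi)
  -- Repeating the exchange restores `σ`, so the downward step reads as an upward one ending in `σ`.
  , (λ k → cong (σ ⟨$⟩ʳ_) (sym (transpose-involutive i j k)))
  , inv
  where
  σ′ = transpose i j ∘ₚ σ
  inv : inversions (word σ) ≡ suc (inversions (word σ′))
  inv with tabulate-exchange (letter σ) (letter σ′) i j i<j
             (cong (letter σ) (transpose-ˡ i j)) (cong (letter σ) (transpose-ʳ i j))
             (λ a≢i a≢j → cong (letter σ) (transpose-fix a≢i a≢j)) outside
  ... | xs , ys , zs , eq , eq′ , out = trans (cong inversions eq)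
    (trans (inversions-exchange σj<σi xs out zs) (cong (suc ∘ inversions) (sym eq′)))

-- Descending from `σ` to `π`.

least : {P : Pred (Fin n) p} → Decidable P →
  (∀ i → ¬ P i) ⊎ (∃[ i ] P i × (∀ {j} → j <ᶠ i → ¬ P j))
least {zero}  P? = inj₁ λ ()
least {suc n} P? with P? zero
... | yes p₀ = inj₂ (zero , p₀ , λ ())
... | no ¬p₀ with least (P? ∘ suc)
...   | inj₁ none            = inj₁ λ { zero → ¬p₀ ; (suc i) → none i }
...   | inj₂ (i , pᵢ , min) = inj₂ (suc i , pᵢ , λ { {zero} _ → ¬p₀ ; {suc j} j<i → min (s≤s⁻¹ j<i) })

-- If σ ⟨$⟩ʳ i were the smaller one, it would occur in π at some b > i; by avoidance the letters
-- of π up to position i all exceed it, hence so would those of σ, including σ ⟨$⟩ʳ i itself.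
first-difference-< : {π σ : Permutation′ n} → Avoids132 π → RunsExtend (letter π) (letter σ) →
  ∀ {i} → π ⟨$⟩ʳ i ≢ σ ⟨$⟩ʳ i → (∀ {a} → a <ᶠ i → π ⟨$⟩ʳ a ≡ σ ⟨$⟩ʳ a) → letter π i < letter σ i
first-difference-< {π = π} {σ} av ext {i} differ agree with ℕ.<-cmp (letter π i) (letter σ i)
... | tri< πi<σi _ _ = πi<σi
... | tri≈ _ πi≡σi _ = contradiction (Fin.toℕ-injective (ℕ.suc-injective πi≡σi)) differ
... | tri> _ _ σi<πi = contradiction (ext (letter σ i) i above) (<-irrefl refl)
  where
  b = π ⟨$⟩ˡ (σ ⟨$⟩ʳ i)

  πb≡σi : letter π b ≡ letter σ i
  πb≡σi = cong (suc ∘ toℕ) (inverseʳ π)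

  πb<πi : letter π b < letter π i
  πb<πi = subst (_< letter π i) (sym πb≡σi) σi<πi

  i<b : i <ᶠ b
  i<b with Fin.<-cmp i b
  ... | tri< i<b _ _ = i<b
  ... | tri≈ _ i≡b _ = contradiction (cong (letter π) (sym i≡b)) (ℕ.<⇒≢ πb<πi)
  ... | tri> _ _ b<i = contradiction
    (letter-injective σ (trans (sym (cong (suc ∘ toℕ) (agree b<i))) πb≡σi)) (Fin.<⇒≢ b<i)

  above : ∀ a → a ≤ᶠ i → letter σ i < letter π a
  above a a≤i with a Fin.≟ i
  ... | yes refl = σi<πi
  ... | no a≢i   = subst (_< letter π a) πb≡σi
    (ℕ.≤∧≢⇒< (ℕ.≮⇒≥ λ πa<πb → av a i b a<i i<b (s≤s⁻¹ πa<πb , s≤s⁻¹ πb<πi))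
             (λ πb≡πa → Fin.<⇒≢ (Fin.<-trans a<i i<b) (sym (letter-injective π πb≡πa))))
    where a<i = Fin.≤∧≢⇒< a≤i a≢i

-- Exchanging σ ⟨$⟩ʳ i with the next letter in the interval [π ⟨$⟩ʳ i , σ ⟨$⟩ʳ i) is a covering
-- step, and both letters still lie where the runs of π allow them.
descend : {π σ : Permutation′ n} → Avoids132 π → RunsExtend (letter π) (letter σ) →
  ∀ {i} → π ⟨$⟩ʳ i ≢ σ ⟨$⟩ʳ i → (∀ {a} → a <ᶠ i → π ⟨$⟩ʳ a ≡ σ ⟨$⟩ʳ a) →
  ∃[ σ′ ] σ′ ⋖ σ × RunsExtend (letter π) (letter σ′)
descend {π = π} {σ} av ext {i} differ agree
  with least (λ a → (i Fin.<? a) ×-dec (letter π i ≤? letter σ a) ×-dec (letter σ a <? letter σ i))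
-- The search cannot fail: the letter of `π` at `i` occurs in `σ` at some `b`, and agreement before
-- `i` together with `πi<σi` forces `b` to the right of `i`.
... | inj₁ none = contradiction
  (i<b , ℕ.≤-reflexive (sym σb≡πi) , subst (_< letter σ i) (sym σb≡πi) πi<σi) (none b)
  where
  πi<σi = first-difference-< {π = π} {σ} av ext differ agree
  b = σ ⟨$⟩ˡ (π ⟨$⟩ʳ i)

  σb≡πi : letter σ b ≡ letter π i
  σb≡πi = cong (suc ∘ toℕ) (inverseʳ σ)

  i<b : i <ᶠ b
  i<b with Fin.<-cmp i b
  ... | tri< i<b _ _ = i<b
  ... | tri≈ _ i≡b _ = contradiction (trans (sym σb≡πi) (cong (letter σ) (sym i≡b))) (ℕ.<⇒≢ πi<σi)
  ... | tri> _ _ b<i = contradiction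
    (letter-injective π (trans (cong (suc ∘ toℕ) (agree b<i)) σb≡πi)) (Fin.<⇒≢ b<i)
... | inj₂ (j , (i<j , πi≤σj , σj<σi) , next) =
  transpose i j ∘ₚ σ , transpose-⋖ σ i<j σj<σi outside , extends
  where
  outside : ∀ {a} → i <ᶠ a → a <ᶠ j → letter σ a < letter σ j ⊎ letter σ i < letter σ a
  outside {a} i<a a<j with ℕ.<-cmp (letter σ a) (letter σ i)
  -- As `j` is the first hit, a letter here below `letter σ i` must miss the interval from beneath.
  ... | tri< σa<σi _ _ =
    inj₁ (ℕ.<-≤-trans (ℕ.≰⇒> λ πi≤σa → next a<j (i<a , πi≤σa , σa<σi)) πi≤σj)
  ... | tri≈ _ σa≡σi _ = contradiction (sym (letter-injective σ σa≡σi)) (Fin.<⇒≢ i<a)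
  ... | tri> _ _ σi<σa = inj₂ σi<σa

  extends : RunsExtend (letter π) (letter (transpose i j ∘ₚ σ))
  extends v k v<π with transposeView i j k
  ... | left  = subst (λ z → v < letter σ z) (sym (transpose-ˡ i j))
    (ℕ.<-≤-trans (v<π i ≤-refl) πi≤σj)
  -- The entry now at `j` is that of `σ` at `i`, controlled by the shorter prefix ending at `i`.
  ... | right = subst (λ z → v < letter σ z) (sym (transpose-ʳ i j))
    (ext v i λ a a≤i → v<π a (≤-trans a≤i (<⇒≤ i<j)))
  ... | fixed k≢i k≢j = subst (λ z → v < letter σ z) (sym (transpose-fix k≢i k≢j)) (ext v k v<π)

-- Every step from `descend` removes exactly one inversion, so `N` bounds the chain length and
-- serves as the induction variable. Avoidance is carried for the fixed `π` only, since intermediate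
-- permutations may contain the pattern.
RunsExtend⇒≤ᴮ : ∀ N {π σ : Permutation′ n} → inversions (word σ) ≤ N → Avoids132 π →
  RunsExtend (letter π) (letter σ) → π ≈ σ ⊎ π <ᴮ σ
RunsExtend⇒≤ᴮ N {π} {σ} inv≤N av ext
  with least (λ i → ¬? (π ⟨$⟩ʳ i Fin.≟ σ ⟨$⟩ʳ i))
... | inj₁ none = inj₁ λ i → decidable-stable (π ⟨$⟩ʳ i Fin.≟ σ ⟨$⟩ʳ i) (none i)
... | inj₂ (i , differ , agree)
  with descend {π = π} {σ} av ext differ
         (λ {a} a<i → decidable-stable (π ⟨$⟩ʳ a Fin.≟ σ ⟨$⟩ʳ a) (agree a<i))
RunsExtend⇒≤ᴮ zero {π} {σ} inv≤N av ext | inj₂ _ | σ′ , (_ , _ , _ , _ , _ , inv) , _ =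
  contradiction (subst (_≤ 0) inv inv≤N) λ ()
RunsExtend⇒≤ᴮ (suc N) {π} {σ} inv≤N av ext | inj₂ _ | σ′ , σ′⋖σ@(_ , _ , _ , _ , _ , inv) , ext′
  with RunsExtend⇒≤ᴮ N {π} {σ′} (s≤s⁻¹ (subst (_≤ suc N) inv inv≤N)) av ext′
... | inj₁ π≈σ′  = inj₂ [ ⋖-respˡ-≈ {π = π} {σ′} {σ} π≈σ′ σ′⋖σ ]
... | inj₂ π<σ′ = inj₂ (π<σ′ ∷ʳ σ′⋖σ)

proposition3p3 : ∀ (n : ℕ) → n ≥ 1 → (π σ : Permutation′ n) →
    Avoids132 π → Avoids132 σ →
    (Λ π ⊂ʸ Λ σ) ⇔ (π <ᴮ σ)
proposition3p3 (suc n) _ π σ av-π av-σ = mk⇔ to from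
  where
  to : Λ π ⊂ʸ Λ σ → π <ᴮ σ
  to (Λπ⊆Λσ , Λπ≢Λσ) with RunsExtend⇒≤ᴮ _ {π} {σ} ≤-refl av-π
    (Equivalence.to (Λ-RunsExtend π σ av-π av-σ) Λπ⊆Λσ)
  ... | inj₁ π≈σ = contradiction
    (cong (reverse ∘ drop 1 ∘ rsBeforeUs 0 ∘ dyck) (word-cong {π = π} {σ} π≈σ)) Λπ≢Λσ
  ... | inj₂ π<σ = π<σ

  from : π <ᴮ σ → Λ π ⊂ʸ Λ σ
  from π<σ = Equivalence.from (Λ-RunsExtend π σ av-π av-σ) (<ᴮ⇒RunsExtend π<σ) , Λπ≢Λσ
    where
    Λπ≢Λσ : Λ π ≢ Λ σ
    -- Equal diagrams would also give the reverse containment, hence `σ` equal to or below `π`; both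
    -- contradict the strict growth of inversions along the chain from `π` to `σ`.
    Λπ≢Λσ Λπ≡Λσ with RunsExtend⇒≤ᴮ _ {σ} {π} ≤-refl av-σ
      (Equivalence.to (Λ-RunsExtend σ π av-σ av-π) (Pointwise.reflexive ℕ.≤-reflexive (Pointwise.≡⇒Pointwise-≡ (sym Λπ≡Λσ))))
    ... | inj₁ σ≈π = <-irrefl (cong inversions (sym (word-cong {π = σ} {π} σ≈π))) (<ᴮ⇒inversions< π<σ)
    ... | inj₂ σ<π = ℕ.<-asym (<ᴮ⇒inversions< π<σ) (<ᴮ⇒inversions< σ<π)
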